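{- Let $G$ be a graph and let $k\ge 1$ be an integer. Then $G$ is a $k$-median graph if and only if $G$ is connected, bipartite and there are $k$ (distinct) vertices $\mu_1,\dots,\mu_k\in V(G)$ such that $G$ satisfies (C0) and (C2) w.r.t. each of $\mu_1,\dots,\mu_k$. In this case (i.e. whenever $G$ is connected, bipartite and satisfies (C0) and (C2) w.r.t. $\mu_1,\dots,\mu_k$), the vertices $\mu_1,\dots,\mu_k$ are median-consistent vertices of $G$.
   Context: All graphs are finite, simple and undirected. A graph is bipartite if its vertex set can be partitioned into two (possibly empty) sets such that every edge joins the two sets. For $x,y\in V(G)$, the interval $I_G(x,y)$ is the set of all vertices lying on shortest $(x,y)$-paths in $G$ (it is empty if $x,y$ lie in different connected components), and $I_G(x,y,z):=I_G(x,y)\cap I_G(x,z)\cap I_G(y,z)$. A vertex $\mu\in V(G)$ is median-consistent in $G$ if $|I_G(\mu,x,y)|=1$ for all $x,y\in V(G)$. A graph is a $k$-median graph ($k\geq 1$) if it has (at least) $k$ median-consistent vertices. For $W\subseteq V(G)$, $G[W]$ denotes the subgraph induced by $W$. For $u\in V(G)$: $G$ satisfies (C0) w.r.t. $u$ if, for all $v,w\in V(G)$, $I_G(u,v)\cap I_G(v,w)=\{v\}$ implies $v\in I_G(u,w)$; $G$ satisfies (C2) w.r.t. $u$ if, for all $v,w\in V(G)$, $G[I_G(u,v,w)]$ contains an edge whenever it contains more than one vertex. -}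

module Defs where

open import Data.Fin using (Fin)
open import Data.Fin.Subset as Subset using (Subset; ∁)
open import Data.List using (List; []; _∷_)
open import Data.List.Membership.Propositional using (_∈_)
open import Data.List.Relation.Unary.Unique.Propositional using (Unique)
open import Data.Nat using (ℕ; suc; _≤_)
open import Data.Product using (∃; ∃₂; ∃!; _×_; proj₁)
open import Data.Sum using (_⊎_)
open import Function using (_on_; _↣_)
open import Function.Bundles using (module Injection)
open import Level using (0ℓ)
open import Relation.Binary using (Rel; Decidable; Symmetric; Irreflexive)
open import Relation.Binary.Construct.Closure.ReflexiveTransitive using (Star; ε; _◅_)
open import Relation.Binary.PropositionalEquality using (_≡_; _≢_)
open import Relation.Unary using (Pred; _∩_; _≐_; ｛_｝)

record Graph : Set₁ where
  field
    order      : ℕ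
    Adj        : Rel (Fin order) 0ℓ
    adj?       : Decidable Adj
    adj-sym    : Symmetric Adj
    adj-irrefl : Irreflexive _≡_ Adj

  V : Set
  V = Fin order

module _ (G : Graph) where
  open Graph G

  Walk : Rel V 0ℓ
  Walk = Star Adj

  Connected : Set
  Connected = ∀ x y → Walk x y

  -- The two parts are A and its complement; either may be empty.
  Bipartite : Set
  Bipartite = ∃ λ (A : Subset order) → ∀ {x y} → Adj x y →
    (x Subset.∈ A × y Subset.∈ ∁ A) ⊎ (x Subset.∈ ∁ A × y Subset.∈ A)

  vertices : ∀ {x y} → Walk x y → List V
  vertices {x} ε       = x ∷ []
  vertices {x} (_ ◅ p) = x ∷ vertices p

  -- The number of edges.
  length : ∀ {x y} → Walk x y → ℕ
  length ε       = 0
  length (_ ◅ p) = suc (length p)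

  IsPath : ∀ {x y} → Walk x y → Set
  IsPath p = Unique (vertices p)

  IsShortestPath : ∀ {x y} → Walk x y → Set
  IsShortestPath {x} {y} p =
    IsPath p × (∀ (q : Walk x y) → IsPath q → length p ≤ length q)

  I : V → V → Pred V 0ℓ
  I x y v = ∃ λ (p : Walk x y) → IsShortestPath p × v ∈ vertices p

  I₃ : V → V → V → Pred V 0ℓ
  I₃ x y z = I x y ∩ I x z ∩ I y z

  -- ∃! _≡_ P expresses |P| = 1.
  MedianConsistent : V → Set
  MedianConsistent μ = ∀ x y → ∃! _≡_ (I₃ μ x y)

  KMedian : ℕ → Set
  KMedian k = ∃ λ (μ : Fin k ↣ V) → ∀ i → MedianConsistent (Injection.to μ i)

  -- The adjacency relation of the subgraph G[W], whose vertices are the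
  -- vertices of G together with a proof of membership in W.
  Induced : (W : Pred V 0ℓ) → Rel (∃ W) 0ℓ
  Induced W = Adj on proj₁

  MoreThanOne : Pred V 0ℓ → Set
  MoreThanOne W = ∃₂ λ a b → W a × W b × a ≢ b

  C0 : V → Set
  C0 u = ∀ v w → (I u v ∩ I v w) ≐ ｛ v ｝ → I u w v

  C2 : V → Set
  C2 u = ∀ v w → MoreThanOne (I₃ u v w) → ∃₂ (Induced (I₃ u v w))

{-# OPTIONS --safe #-}
module Submission where

-- Shortest paths are length-minimal walks, so v ∈ I(x,y) means d(x,v) + d(v,y) ≤ d(x,y).
-- A median of u, x, y is reached by moving z ∈ I(u,x) ∩ I(x,y) towards u until
-- I(u,z) ∩ I(z,y) = {z}; then (C0) puts z in I(u,y).  It is unique because an edge ab inside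
-- I(u,x,y) would, as d(u,a) ≠ d(u,b) by bipartiteness, have an end that is strictly closer to
-- both x and y than the other, although both ends lie on shortest (x,y)-paths.
-- Conversely, the median of u and an edge xy is x or y, so d(u,-) changes by exactly one along
-- every edge, and its parity is a proper 2-colouring.

open import Data.Bool using (Bool; true; false; not)
open import Data.Bool.Properties using (not-¬; ¬-not; not-involutive)
open import Data.Fin using (Fin; zero; _≟_)
open import Data.Fin.Properties using (any?)
import Data.Fin.Subset as Subset
open import Data.Fin.Subset.Properties using (x∉p⇒x∈∁p; x∈∁p⇒x∉p)
open import Data.List.Membership.Propositional using (_∈_)
open import Data.List.Relation.Unary.All.Properties using (¬Any⇒All¬)
open import Data.List.Relation.Unary.AllPairs using ([]; _∷_)
import Data.List.Relation.Unary.All as All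
open import Data.List.Relation.Unary.Any using (here; there)
open import Data.Nat using (ℕ; zero; suc; _+_; _≤_; _<_; _≥_; _≤?_)
open import Data.Nat.Induction using (<-rec)
open import Data.Nat.Properties hiding (_≟_; _≤?_)
open import Data.Product using (∃; ∃₂; _×_; _,_; proj₁; proj₂)
open import Data.Sum using (_⊎_; inj₁; inj₂)
open import Data.Vec using (lookup; tabulate)
open import Data.Vec.Properties using (lookup⇒[]=; []=⇒lookup; lookup∘tabulate)
open import Function using (_⇔_; _↣_; mk⇔; _∘_)
open import Function.Bundles using (module Injection)
open import Relation.Binary using (tri<; tri≈; tri>)
open import Relation.Binary.Construct.Closure.ReflexiveTransitive
  using (ε; _◅_; _◅◅_)
open import Relation.Binary.PropositionalEquality
  using (_≡_; _≢_; refl; sym; trans; cong)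
open import Relation.Nullary using (¬_; Dec; yes; no; contradiction)
open import Relation.Nullary.Decidable using (map′; _×-dec_; ¬?)
open import Relation.Unary using (_∩_)
open import Defs

isEven : ℕ → Bool
isEven zero    = true
isEven (suc n) = not (isEven n)

-- Walks and geodesics.

module Walks (G : Graph) where
  open Graph G

  -- Competes against all walks, whereas `IsShortestPath` competes against paths only;
  -- `geodesic⇒isPath` bridges the two.
  Geodesic : ∀ {x y} → Walk G x y → Set
  Geodesic {x} {y} p = ∀ (q : Walk G x y) → length G p ≤ length G q

  length-◅◅ : ∀ {x y z} (p : Walk G x y) (q : Walk G y z) →
    length G (p ◅◅ q) ≡ length G p + length G q
  length-◅◅ ε       q = refl
  length-◅◅ (_ ◅ p) q = cong suc (length-◅◅ p q)

  reversal : ∀ {x y} (p : Walk G x y) →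
    ∃ λ (q : Walk G y x) → length G q ≡ length G p
  reversal ε       = ε , refl
  reversal (e ◅ p) with reversal p
  ... | q , eq = q ◅◅ (adj-sym e ◅ ε) ,
    trans (length-◅◅ q _) (trans (+-comm _ 1) (cong suc eq))

  start∈vertices : ∀ {x y} (p : Walk G x y) → x ∈ vertices G p
  start∈vertices ε       = here refl
  start∈vertices (_ ◅ _) = here refl

  joint∈vertices : ∀ {x v y} (p : Walk G x v) (q : Walk G v y) →
    v ∈ vertices G (p ◅◅ q)
  joint∈vertices ε       q = start∈vertices q
  joint∈vertices (_ ◅ p) q = there (joint∈vertices p q)

  split : ∀ {x v y} (p : Walk G x y) → v ∈ vertices G p →
    ∃₂ λ (q : Walk G x v) (r : Walk G v y) → length G q + length G r ≡ length G p
  split ε       (here refl) = ε , ε , refl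
  split (e ◅ p) (here refl) = ε , e ◅ p , refl
  split (e ◅ p) (there v∈p) with split p v∈p
  ... | q , r , eq = e ◅ q , r , cong suc eq

  -- If the first vertex recurred, the walk from its recurrence onwards would be strictly shorter
  -- than the whole.
  geodesic⇒isPath : ∀ {x y} (p : Walk G x y) → Geodesic p → IsPath G p
  geodesic⇒isPath ε       _   = All.[] ∷ []
  geodesic⇒isPath (e ◅ p) min =
    ¬Any⇒All¬ _ x∉p ∷ geodesic⇒isPath p (λ q → ≤-pred (min (e ◅ q)))
    where
    x∉p : ¬ (_ ∈ vertices G p)
    x∉p x∈p with split p x∈p
    ... | q , r , eq = <-irrefl refl
      (≤-trans (min r) (≤-trans (m≤n+m _ (length G q)) (≤-reflexive eq)))

  WalkOfLength : ℕ → V → V → Set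
  WalkOfLength n x y = ∃ λ (p : Walk G x y) → length G p ≡ n

  walkOfLength? : ∀ n x y → Dec (WalkOfLength n x y)
  walkOfLength? zero x y =
    map′ (λ { refl → ε , refl }) (λ { (ε , _) → refl }) (x ≟ y)
  walkOfLength? (suc n) x y =
    map′ (λ { (_ , e , p , eq) → e ◅ p , cong suc eq })
         (λ { (e ◅ p , eq) → _ , e , p , suc-injective eq })
         (any? λ z → adj? x z ×-dec walkOfLength? n z y)

  -- Descent on the length: whether a shorter walk exists is settled by a bounded search, since
  -- walks of a fixed length are decidable.
  geodesic : ∀ {x y} → Walk G x y → ∃ λ (p : Walk G x y) → Geodesic p
  geodesic {x} {y} p = <-rec _ shorten (length G p) (p , refl)
    where
    shorten : ∀ n → (∀ {m} → m < n → WalkOfLength m x y → ∃ (Geodesic {x} {y})) →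
      WalkOfLength n x y → ∃ (Geodesic {x} {y})
    shorten n rec (p , refl) with anyUpTo? (λ m → walkOfLength? m x y) n
    ... | yes (_ , m<n , q) = rec m<n q
    ... | no  ¬shorter      = p , λ q → ≮⇒≥ (λ q<p → ¬shorter (_ , q<p , q , refl))

  -- Bipartitions as Boolean colourings.

  Proper : (V → Bool) → Set
  Proper c = ∀ {x y} → Adj x y → c x ≡ not (c y)

  bipartite⇒proper : Bipartite G → ∃ Proper
  bipartite⇒proper (A , parts) = lookup A , λ e → ¬-not (differ (parts e))
    where
    differ : ∀ {x y} →
      (x Subset.∈ A × y Subset.∈ Subset.∁ A) ⊎ (x Subset.∈ Subset.∁ A × y Subset.∈ A) →
      lookup A x ≢ lookup A y
    differ (inj₁ (x∈A , y∈∁A)) eq =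
      x∈∁p⇒x∉p y∈∁A (lookup⇒[]= _ A (trans (sym eq) ([]=⇒lookup x∈A)))
    differ (inj₂ (x∈∁A , y∈A)) eq =
      x∈∁p⇒x∉p x∈∁A (lookup⇒[]= _ A (trans eq ([]=⇒lookup y∈A)))

  proper⇒bipartite : ∀ {c} → Proper c → Bipartite G
  proper⇒bipartite {c} proper = A , λ e → parts (proper e)
    where
    A = tabulate c

    ∈A : ∀ {x} → c x ≡ true → x Subset.∈ A
    ∈A cx = lookup⇒[]= _ A (trans (lookup∘tabulate c _) cx)

    ∈∁A : ∀ {x} → c x ≡ false → x Subset.∈ Subset.∁ A
    ∈∁A cx = x∉p⇒x∈∁p λ x∈A →
      not-¬ (trans (sym (lookup∘tabulate c _)) ([]=⇒lookup x∈A)) cx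

    parts : ∀ {x y} → c x ≡ not (c y) →
      (x Subset.∈ A × y Subset.∈ Subset.∁ A) ⊎ (x Subset.∈ Subset.∁ A × y Subset.∈ A)
    parts {y = y} eq with c y in cy
    ... | true  = inj₂ (∈∁A eq , ∈A cy)
    ... | false = inj₁ (∈A eq , ∈∁A cy)

  -- Colours alternate along a walk. The two starts may differ, because after one step from a common
  -- start the walks can stand at different vertices.
  sameColour : ∀ {c} → Proper c → ∀ {x x′ y y′} (p : Walk G x y) (q : Walk G x′ y′) →
    length G p ≡ length G q → c x ≡ c x′ → c y ≡ c y′
  sameColour proper ε       ε       _  eq = eq
  sameColour proper (e ◅ p) (f ◅ q) ≡ℓ eq =
    sameColour proper p q (suc-injective ≡ℓ)
      (trans (proper (adj-sym e)) (trans (cong not eq) (sym (proper (adj-sym f)))))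

-- The graph metric and its intervals.

module Distance (G : Graph) (connected : Connected G) where
  open Graph G
  open Walks G

  shortest : ∀ x y → Walk G x y
  shortest x y = proj₁ (geodesic (connected x y))

  d : V → V → ℕ
  d x y = length G (shortest x y)

  d-minimal : ∀ {x y} (p : Walk G x y) → d x y ≤ length G p
  d-minimal {x} {y} = proj₂ (geodesic (connected x y))

  d-triangle : ∀ x v y → d x y ≤ d x v + d v y
  d-triangle x v y = ≤-trans (d-minimal (shortest x v ◅◅ shortest v y))
    (≤-reflexive (length-◅◅ (shortest x v) (shortest v y)))

  d-sym-≤ : ∀ x y → d x y ≤ d y x
  d-sym-≤ x y with reversal (shortest y x)
  ... | p , eq = ≤-trans (d-minimal p) (≤-reflexive eq)

  d-sym : ∀ x y → d x y ≡ d y x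
  d-sym x y = ≤-antisym (d-sym-≤ x y) (d-sym-≤ y x)

  d-refl : ∀ x → d x x ≡ 0
  d-refl x = n≤0⇒n≡0 (d-minimal ε)

  d≡0⇒≡ : ∀ {x y} → d x y ≡ 0 → x ≡ y
  -- A walk with an edge has positive length, which `eq` excludes.
  d≡0⇒≡ {x} {y} eq with ε ← shortest x y = refl

  adj⇒d≡1 : ∀ {x y} → Adj x y → d x y ≡ 1
  adj⇒d≡1 e = ≤-antisym (d-minimal (e ◅ ε)) (n≢0⇒n>0 (λ eq → adj-irrefl (d≡0⇒≡ eq) e))

  -- Equality in the triangle inequality; the other half is `d-triangle`.
  Between : V → V → V → Set
  Between x y v = d x v + d v y ≤ d x y

  between? : ∀ x y v → Dec (Between x y v)
  between? x y v = d x v + d v y ≤? d x y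

  I⇒between : ∀ {x y v} → I G x y v → Between x y v
  I⇒between {x} {y} {v} (p , (_ , min) , v∈p) with split p v∈p
  ... | q , r , eq = begin
    d x v + d v y             ≤⟨ +-mono-≤ (d-minimal q) (d-minimal r) ⟩
    length G q + length G r   ≡⟨ eq ⟩
    -- `min` compares with paths only, so `shortest x y` must be shown to be one.
    length G p                ≤⟨ min _ (geodesic⇒isPath (shortest x y) d-minimal) ⟩
    d x y                     ∎
    where open ≤-Reasoning

  between⇒I : ∀ {x y v} → Between x y v → I G x y v
  between⇒I {x} {y} {v} b =
    p , (geodesic⇒isPath p p-geodesic , λ q _ → p-geodesic q) ,
    joint∈vertices (shortest x v) (shortest v y)
    where
    p = shortest x v ◅◅ shortest v y

    p-geodesic : Geodesic p
    p-geodesic q =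
      ≤-trans (≤-reflexive (length-◅◅ (shortest x v) (shortest v y))) (≤-trans b (d-minimal q))

  between-sym : ∀ {x y v} → Between x y v → Between y x v
  between-sym {x} {y} {v} b
    rewrite d-sym y v | d-sym v x | d-sym y x | +-comm (d v y) (d x v) = b

  between-end : ∀ x y → Between x y y
  between-end x y rewrite d-refl y = ≤-reflexive (+-identityʳ _)

  between-transˡ : ∀ {x y z t} → Between x y z → Between x z t → Between x y t
  between-transˡ {x} {y} {z} {t} xzy xtz = begin
    d x t + d t y            ≤⟨ +-monoʳ-≤ (d x t) (d-triangle t z y) ⟩
    d x t + (d t z + d z y)  ≡⟨ +-assoc (d x t) _ _ ⟨
    d x t + d t z + d z y    ≤⟨ +-monoˡ-≤ (d z y) xtz ⟩
    d x z + d z y            ≤⟨ xzy ⟩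
    d x y                    ∎
    where open ≤-Reasoning

  between-transʳ : ∀ {x y z t} → Between x y z → Between z y t → Between x y t
  between-transʳ xzy zty = between-sym (between-transˡ (between-sym xzy) (between-sym zty))

  between-< : ∀ {x y t} → Between x y t → t ≢ y → d x t < d x y
  between-< {x} {y} {t} b t≢y =
    <-≤-trans (m<m+n (d x t) (n≢0⇒n>0 (t≢y ∘ d≡0⇒≡))) b

  -- Medians from (C0) and (C2).

  C0⇒median : ∀ {u} → C0 G u → ∀ x y → ∃ (I₃ G u x y)
  C0⇒median {u} c0 x y =
    -- Descent on `d u z`, starting from `z = x`, which is an end of both intervals.
    <-rec _ descend (d u x) x refl (between-end u x) (between-sym (between-end y x))
    where
    descend : ∀ n →
      (∀ {m} → m < n → ∀ z → d u z ≡ m → Between u x z → Between x y z → ∃ (I₃ G u x y)) →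
      ∀ z → d u z ≡ n → Between u x z → Between x y z → ∃ (I₃ G u x y)
    descend _ rec z refl uzx xzy
      -- Such a `t` is strictly closer to `u` and, by transitivity, stays in both intervals; if
      -- there is none, the premise of (C0) holds at `z`.
      with any? (λ t → between? u z t ×-dec between? z y t ×-dec ¬? (t ≟ z))
    ... | yes (t , utz , zty , t≢z) =
      rec (between-< utz t≢z) t refl (between-transˡ uzx utz) (between-transʳ xzy zty)
    ... | no ¬closer = z , between⇒I uzx , c0 z y (only-z , z-in) , between⇒I xzy
      where
      only-z : ∀ {t} → (I G u z ∩ I G z y) t → z ≡ t
      only-z {t} (utz , zty) with t ≟ z
      ... | yes eq  = sym eq
      ... | no  t≢z = contradiction (t , I⇒between utz , I⇒between zty , t≢z) ¬closer

      z-in : ∀ {t} → z ≡ t → (I G u z ∩ I G z y) t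
      z-in refl = between⇒I (between-end u z) , between⇒I (between-sym (between-end y z))

  -- Geodesics of equal length from `u` end in the same colour, but neighbours differ in colour.
  adj⇒d-≢ : Bipartite G → ∀ u {a b} → Adj a b → d u a ≢ d u b
  adj⇒d-≢ bip u {a} {b} e eq with bipartite⇒proper bip
  ... | _ , proper = not-¬ (sameColour proper (shortest u a) (shortest u b) eq refl) (proper e)

  -- The detour through `a` cannot beat the geodesic through `b`, so what `a` saves before it must
  -- be lost after it.
  between-closer : ∀ {u a b x} → d u a < d u b → Between u x b → d b x < d a x
  between-closer {u} {a} {b} {x} a<b ubx = +-cancelˡ-< (d u a) _ _ (begin-strict
    d u a + d b x  <⟨ +-monoˡ-< (d b x) a<b ⟩
    d u b + d b x  ≤⟨ ubx ⟩
    d u x          ≤⟨ d-triangle u a x ⟩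
    d u a + d a x  ∎)
    where open ≤-Reasoning

  I₃-equidistant : ∀ {u x y a b} → I₃ G u x y a → I₃ G u x y b → ¬ (d u a < d u b)
  I₃-equidistant {u} {x} {y} {a} {b} (_ , _ , xay) (ubx , uby , _) a<b =
    <-irrefl refl (begin-strict
      d x b + d b y  ≡⟨ cong (_+ d b y) (d-sym x b) ⟩
      d b x + d b y  <⟨ +-mono-< (between-closer a<b (I⇒between ubx))
                                 (between-closer a<b (I⇒between uby)) ⟩
      d a x + d a y  ≡⟨ cong (_+ d a y) (d-sym a x) ⟩
      d x a + d a y  ≤⟨ I⇒between xay ⟩
      d x y          ≤⟨ d-triangle x b y ⟩
      d x b + d b y  ∎)
    where open ≤-Reasoning

  C0∧C2⇒medianConsistent : Bipartite G → ∀ {u} → C0 G u → C2 G u → MedianConsistent G u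
  C0∧C2⇒medianConsistent bip {u} c0 c2 x y with C0⇒median c0 x y
  ... | m , m∈I₃ = m , m∈I₃ , unique
    where
    noEdge : ¬ ∃₂ (Induced G (I₃ G u x y))
    noEdge ((a , a∈I₃) , (b , b∈I₃) , e) with <-cmp (d u a) (d u b)
    ... | tri< a<b _ _ = I₃-equidistant a∈I₃ b∈I₃ a<b
    ... | tri≈ _ a≡b _ = adj⇒d-≢ bip u e a≡b
    ... | tri> _ _ b<a = I₃-equidistant b∈I₃ a∈I₃ b<a

    unique : ∀ {m′} → I₃ G u x y m′ → m ≡ m′
    unique {m′} m′∈I₃ with m ≟ m′
    ... | yes eq = eq
    -- (C2) turns a second median into an edge between medians.
    ... | no  m≢m′ = contradiction (c2 x y (m , m′ , m∈I₃ , m′∈I₃ , m≢m′)) noEdge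

  -- Consequences of median-consistency.

  between-adj⇒endpoint : ∀ {x y m} → Adj x y → Between x y m → x ≡ m ⊎ m ≡ y
  between-adj⇒endpoint {x} {y} {m} e xmy with d x m in xm
  ... | zero  = inj₁ (d≡0⇒≡ xm)
  ... | suc k = inj₂ (d≡0⇒≡ (n≤0⇒n≡0
    (≤-trans (m≤n+m _ k) (≤-pred (≤-trans xmy (≤-reflexive (adj⇒d≡1 e)))))))

  between-adj⇒suc : ∀ {u x y} → Adj x y → Between u y x → d u y ≡ suc (d u x)
  between-adj⇒suc {u} {x} {y} e uxy = trans (≤-antisym (d-triangle u x y) uxy)
    (trans (cong (d u x +_) (adj⇒d≡1 e)) (+-comm _ 1))

  medianConsistent⇒bipartite : ∀ {u} → MedianConsistent G u → Bipartite G
  medianConsistent⇒bipartite {u} mc = proper⇒bipartite {isEven ∘ d u} proper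
    where
    proper : Proper (isEven ∘ d u)
    proper {x} {y} e with mc x y
    ... | m , (umx , umy , xmy) , _ with between-adj⇒endpoint e (I⇒between xmy)
    -- The end that is the median lies on a geodesic from `u` to the other end.
    ... | inj₁ refl rewrite between-adj⇒suc e (I⇒between umy) = sym (not-involutive _)
    ... | inj₂ refl rewrite between-adj⇒suc (adj-sym e) (I⇒between umx) = refl

module _ {G : Graph} where

  -- A median lies on actual paths from `u` to `x` and to `y`; these are joined at `u`.
  medianConsistent⇒connected : ∀ {u} → MedianConsistent G u → Connected G
  medianConsistent⇒connected {u} mc x y with mc x y
  ... | _ , ((p , _) , (q , _) , _) , _ = proj₁ (Walks.reversal G p) ◅◅ q

  -- The premise forces the median of `u`, `v`, `w` to be `v`, and a median also lies between `u`
  -- and `w`.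
  medianConsistent⇒C0 : ∀ {u} → MedianConsistent G u → C0 G u
  medianConsistent⇒C0 mc v w (only-v , _) with mc v w
  ... | _ , (umv , umw , vmw) , _ with refl ← only-v (umv , vmw) = umw

  -- Vacuous, as no triple interval at `u` has two elements.
  medianConsistent⇒C2 : ∀ {u} → MedianConsistent G u → C2 G u
  medianConsistent⇒C2 mc v w (a , b , a∈I₃ , b∈I₃ , a≢b) with mc v w
  ... | _ , _ , unique = contradiction (trans (sym (unique a∈I₃)) (unique b∈I₃)) a≢b

mainTheorem3 : (G : Graph) (k : ℕ) → k ≥ 1 →
    (KMedian G k ⇔
    (Connected G × Bipartite G ×
    (∃ λ (μ : Fin k ↣ Graph.V G) →
    ∀ i → C0 G (Injection.to μ i) × C2 G (Injection.to μ i))))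
    × (Connected G → Bipartite G → (μ : Fin k ↣ Graph.V G) →
    (∀ i → C0 G (Injection.to μ i) × C2 G (Injection.to μ i)) →
    ∀ i → MedianConsistent G (Injection.to μ i))
mainTheorem3 G (suc k) _ = mk⇔ necessary sufficient , consistent
  where
  consistent : Connected G → Bipartite G → (μ : Fin (suc k) ↣ Graph.V G) →
    (∀ i → C0 G (Injection.to μ i) × C2 G (Injection.to μ i)) →
    ∀ i → MedianConsistent G (Injection.to μ i)
  consistent connected bip μ c i =
    Distance.C0∧C2⇒medianConsistent G connected bip (proj₁ (c i)) (proj₂ (c i))

  necessary : KMedian G (suc k) → Connected G × Bipartite G ×
    (∃ λ (μ : Fin (suc k) ↣ Graph.V G) →
      ∀ i → C0 G (Injection.to μ i) × C2 G (Injection.to μ i))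
  necessary (μ , mc) =
    -- One median-consistent vertex suffices here, and index `zero` exists because the number of
    -- them is positive.
    connected , Distance.medianConsistent⇒bipartite G connected (mc zero) ,
    μ , λ i → medianConsistent⇒C0 (mc i) , medianConsistent⇒C2 (mc i)
    where
    connected : Connected G
    connected = medianConsistent⇒connected (mc zero)

  sufficient : (Connected G × Bipartite G ×
    (∃ λ (μ : Fin (suc k) ↣ Graph.V G) →
      ∀ i → C0 G (Injection.to μ i) × C2 G (Injection.to μ i))) → KMedian G (suc k)
  sufficient (connected , bip , μ , c) = μ , consistent connected bip μ c
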